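{- For each type composition $\widehat{n}$ in the list $(2,4)$, $(2,2,2)$, $(1,1,5)$, $(1,2,3)$, $(1,3,2)$, $(2,1,4)$, $(2,4,1)$, $(1,1,1,3)$, $(1,1,3,1)$, $(2,1,2,1)$, $(2,3,1,1)$, $(1,2,2,1)$, $(1,2,1,2)$, $(1,1,2,2)$, $(1,2,1,1,1)$, $(1,1,2,1,1)$, $(1,1,1,2,1)$, $(1,1,1,1,2)$ there exists a non-weighted complete simple game with type composition $\widehat{n}$.
   Context: A simple game is a pair $(v,N)$ with $N$ a finite set (of agents) and $v:2^N\to\{0,1\}$ satisfying $v(\emptyset)=0$, $v(N)=1$, and $v(S)\le v(T)$ for all $S\subseteq T\subseteq N$. For agents $i,j$ write $i\sqsupset j$ if $v(\{i\}\cup S\setminus\{j\})\ge v(S)$ for all $\{j\}\subseteq S\subseteq N\setminus\{i\}$, and $i\,\square\, j$ if both $i\sqsupset j$ and $j\sqsupset i$. A simple game is complete if $\sqsupset$ is a total preorder (reflexive, total, transitive). The relation $\square$ partitions $N$ into equivalence classes $N_1,\dots,N_t$, numbered in order of decreasing desirability (agents in $N_1$ are the most desirable with respect to $\sqsupset$); $t$ is the number of types and $(n_1,\dots,n_t)\in\mathbb{N}_{>0}^t$ with $n_i=|N_i|$ is the type composition of the game. A simple game $(v,N)$ is weighted if there exist weights $w_i\in\mathbb{R}_{\ge 0}$ for $i\in N$ and a quota $q\in\mathbb{R}_{>0}$ such that, for all $S\subseteq N$, $v(S)=1$ if and only if $\sum_{i\in S}w_i\ge q$; otherwise it is non-weighted.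 -}

module Defs where

open import Data.Bool.Base as Bool using (Bool; true; false)
open import Data.Fin.Base using (Fin; zero; suc) renaming (_<_ to _<ᶠ_)
open import Data.Fin.Subset using (Subset; inside; outside; _∈_; _∉_; _⊆_; ⊥; ⊤; ⁅_⁆; _∪_; _-_; ∣_∣; Nonempty)
open import Data.List.Base using (List; []; _∷_; length; lookup)
open import Data.Nat.Base as ℕ using (ℕ; zero; suc; _⊔_)
import Data.Nat.Properties as ℕ
open import Data.Product.Base using (Σ-syntax; ∃-syntax; _×_; _,_)
open import Data.Rational.Base as ℚ using (ℚ; 0ℚ; ½)
import Data.Rational.Properties as ℚ
open import Data.Rational.Solver using (module +-*-Solver)
open import Data.Vec.Base using ([]; _∷_)
open import Function.Base using (_∘_)
open import Function.Bundles using (_⇔_)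
open import Relation.Binary.PropositionalEquality using (_≡_; refl; cong; subst; trans; sym)
open import Relation.Binary.Structures using (IsTotalPreorder)
open import Relation.Nullary.Negation.Core using (¬_)

-- Real numbers as Cauchy sequences of rationals.  There is no quotient:
-- sequences with the same limit are identified only through _≤ʳ_.

IsCauchy : (ℕ → ℚ) → Set
IsCauchy x = ∀ ε → 0ℚ ℚ.< ε →
  ∃[ N ] (∀ m n → N ℕ.≤ m → N ℕ.≤ n → ℚ.∣ x m ℚ.- x n ∣ ℚ.< ε)

record ℝ : Set where
  constructor mkℝ
  field
    seq    : ℕ → ℚ
    cauchy : IsCauchy seq

open ℝ public

infix 4 _≤ʳ_ _<ʳ_
infixl 6 _+ʳ_

_≤ʳ_ : ℝ → ℝ → Set
x ≤ʳ y = ∀ ε → 0ℚ ℚ.< ε →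
  ∃[ N ] (∀ n → N ℕ.≤ n → seq x n ℚ.≤ seq y n ℚ.+ ε)

_<ʳ_ : ℝ → ℝ → Set
x <ʳ y = ∃[ ε ] (0ℚ ℚ.< ε ×
  ∃[ N ] (∀ n → N ℕ.≤ n → seq x n ℚ.+ ε ℚ.≤ seq y n))

0ʳ : ℝ
0ʳ = mkℝ (λ _ → 0ℚ) (λ ε 0<ε → 0 , λ _ _ _ _ → 0<ε)

private
  half-pos : ∀ {ε} → 0ℚ ℚ.< ε → 0ℚ ℚ.< ½ ℚ.* ε
  half-pos {ε} 0<ε =
    subst (ℚ._< ½ ℚ.* ε) (ℚ.*-zeroʳ ½) (ℚ.*-monoʳ-<-pos ½ 0<ε)

  half+half : ∀ ε → ½ ℚ.* ε ℚ.+ ½ ℚ.* ε ≡ ε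
  half+half ε = trans (sym (ℚ.*-distribʳ-+ ε ½ ½)) (ℚ.*-identityˡ ε)

  interchange : ∀ a b c d →
    (a ℚ.+ b) ℚ.- (c ℚ.+ d) ≡ (a ℚ.- c) ℚ.+ (b ℚ.- d)
  interchange = solve 4 (λ a b c d →
    (a :+ b) :- (c :+ d) := (a :- c) :+ (b :- d)) refl
    where open +-*-Solver

  +-cauchy : ∀ x y → IsCauchy x → IsCauchy y → IsCauchy (λ n → x n ℚ.+ y n)
  +-cauchy x y cx cy ε 0<ε
    with cx (½ ℚ.* ε) (half-pos 0<ε) | cy (½ ℚ.* ε) (half-pos 0<ε)
  ... | M , p | N , q = M ⊔ N , λ m n h k → begin-strict
    ℚ.∣ (x m ℚ.+ y m) ℚ.- (x n ℚ.+ y n) ∣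
      ≡⟨ cong ℚ.∣_∣ (interchange (x m) (y m) (x n) (y n)) ⟩
    ℚ.∣ (x m ℚ.- x n) ℚ.+ (y m ℚ.- y n) ∣
      ≤⟨ ℚ.∣p+q∣≤∣p∣+∣q∣ (x m ℚ.- x n) (y m ℚ.- y n) ⟩
    ℚ.∣ x m ℚ.- x n ∣ ℚ.+ ℚ.∣ y m ℚ.- y n ∣
      <⟨ ℚ.+-mono-< (p m n (ℕ.m⊔n≤o⇒m≤o M N h) (ℕ.m⊔n≤o⇒m≤o M N k))
                    (q m n (ℕ.m⊔n≤o⇒n≤o M N h) (ℕ.m⊔n≤o⇒n≤o M N k)) ⟩
    ½ ℚ.* ε ℚ.+ ½ ℚ.* ε
      ≡⟨ half+half ε ⟩
    ε ∎
    where open ℚ.≤-Reasoning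

_+ʳ_ : ℝ → ℝ → ℝ
x +ʳ y = mkℝ (λ n → seq x n ℚ.+ seq y n) (+-cauchy (seq x) (seq y) (cauchy x) (cauchy y))

-- sum S w = Σ_{i ∈ S} w i
sum : ∀ {n} → Subset n → (Fin n → ℝ) → ℝ
sum []            w = 0ʳ
sum (inside  ∷ S) w = w zero +ʳ sum S (w ∘ suc)
sum (outside ∷ S) w = sum S (w ∘ suc)

-- The agents are the elements of Fin n, and the values 0 and 1 of v are
-- false and true, ordered by false ≤ true.

record SimpleGame (n : ℕ) : Set where
  field
    v        : Subset n → Bool
    v-∅      : v ⊥ ≡ false
    v-N      : v ⊤ ≡ true
    monotone : ∀ S T → S ⊆ T → v S Bool.≤ v T

module _ {n : ℕ} (G : SimpleGame n) where
  open SimpleGame G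

  infix 4 _⊒_ _□_

  _⊒_ : Fin n → Fin n → Set
  i ⊒ j = ∀ S → j ∈ S → i ∉ S → v S Bool.≤ v ((⁅ i ⁆ ∪ S) - j)

  _□_ : Fin n → Fin n → Set
  i □ j = i ⊒ j × j ⊒ i

  Complete : Set
  Complete = IsTotalPreorder _≡_ _⊒_

  -- class enumerates the equivalence classes N₁, …, N_t of _□_, from the
  -- most to the least desirable agents; disjointness of distinct classes
  -- follows from decreasing.
  record HasTypeComposition (n̂ : List ℕ) : Set where
    field
      class      : Fin (length n̂) → Subset n
      nonempty   : ∀ k → Nonempty (class k)
      covering   : ∀ i → ∃[ k ] i ∈ class k
      equivalent : ∀ k {i} → i ∈ class k → ∀ j → j ∈ class k ⇔ i □ j
      decreasing : ∀ {k l} → k <ᶠ l → ∀ {i j} → i ∈ class k → j ∈ class l →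
                   i ⊒ j × ¬ (j ⊒ i)
      sizes      : ∀ k → ∣ class k ∣ ≡ lookup n̂ k

  Weighted : Set
  Weighted = Σ[ w ∈ (Fin n → ℝ) ] Σ[ q ∈ ℝ ]
    (∀ i → 0ʳ ≤ʳ w i) × 0ʳ <ʳ q × (∀ S → v S ≡ true ⇔ q ≤ʳ sum S w)

typeCompositions : List (List ℕ)
typeCompositions =
  (2 ∷ 4 ∷ []) ∷
  (2 ∷ 2 ∷ 2 ∷ []) ∷
  (1 ∷ 1 ∷ 5 ∷ []) ∷
  (1 ∷ 2 ∷ 3 ∷ []) ∷
  (1 ∷ 3 ∷ 2 ∷ []) ∷
  (2 ∷ 1 ∷ 4 ∷ []) ∷
  (2 ∷ 4 ∷ 1 ∷ []) ∷
  (1 ∷ 1 ∷ 1 ∷ 3 ∷ []) ∷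
  (1 ∷ 1 ∷ 3 ∷ 1 ∷ []) ∷
  (2 ∷ 1 ∷ 2 ∷ 1 ∷ []) ∷
  (2 ∷ 3 ∷ 1 ∷ 1 ∷ []) ∷
  (1 ∷ 2 ∷ 2 ∷ 1 ∷ []) ∷
  (1 ∷ 2 ∷ 1 ∷ 2 ∷ []) ∷
  (1 ∷ 1 ∷ 2 ∷ 2 ∷ []) ∷
  (1 ∷ 2 ∷ 1 ∷ 1 ∷ 1 ∷ []) ∷
  (1 ∷ 1 ∷ 2 ∷ 1 ∷ 1 ∷ []) ∷
  (1 ∷ 1 ∷ 1 ∷ 2 ∷ 1 ∷ []) ∷
  (1 ∷ 1 ∷ 1 ∷ 1 ∷ 2 ∷ []) ∷
  []

{-# OPTIONS --safe #-}
-- Each game consists of the coalitions whose numbers of agents of the k best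
-- types, for every k, are at least those of one of a few given coalitions,
-- among them A and B.  It is not weighted because some losing coalitions C
-- and D satisfy A ∪ B = C ∪ D and A ∩ B = C ∩ D: then the weights satisfy
-- w(A) + w(B) = w(C) + w(D), although w(C), w(D) < q ≤ w(A), w(B).
module Submission where

open import Defs
open import Data.Bool.Base as Bool using (Bool; true; false)
import Data.Bool.Properties as Bool
open import Data.Fin.Base using (Fin; splitAt)
  renaming (zero to fzero; suc to fsuc; _≤_ to _≤ᶠ_; _<_ to _<ᶠ_)
import Data.Fin.Properties as Fin
open import Data.Fin.Subset
  using (Subset; inside; outside; _⊆_; ⊥; ⊤; _∪_; _∩_; ∣_∣; Nonempty; ⁅_⁆; _-_)
  renaming (_∈_ to _∈ˢ_)
open import Data.Fin.Subset.Properties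
  using (_∈?_; anySubset?; nonempty?; p⊆q⇒∣p∣≤∣q∣; ⊆-refl; ⊆⊤; ⊥⊆; x∈p∩q⁺; x∈p∩q⁻)
open import Data.List.Base using (List; []; _∷_; length; lookup)
open import Data.List.Membership.Propositional using (_∈_)
open import Data.List.Relation.Unary.All as All using (All; []; _∷_)
open import Data.List.Relation.Unary.Any as Any using (Any; here; there)
open import Data.Nat.Base as ℕ using (ℕ; zero; suc)
import Data.Nat.ListAction as ℕ
import Data.Nat.Properties as ℕ
open import Data.Product.Base using (Σ-syntax; ∃-syntax; _×_; _,_; proj₁; proj₂)
open import Data.Rational.Base as ℚ using (ℚ; 0ℚ; ½)
import Data.Rational.Properties as ℚ
open import Data.Rational.Solver using (module +-*-Solver)
open import Data.Sum.Base as Sum using (inj₁; inj₂; [_,_])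
open import Data.Vec.Base using ([]; _∷_; tabulate)
open import Data.Vec.Properties using (lookup∘tabulate; lookup⇒[]=; []=⇒lookup; ≡-dec)
open import Function.Base using (_∘_; const)
open import Function.Bundles using (mk⇔; module Equivalence)
open import Relation.Binary.Definitions using (Decidable)
open import Relation.Binary.PropositionalEquality
  using (_≡_; refl; sym; trans; cong; cong₂; subst; subst₂; isEquivalence)
open import Relation.Nullary.Decidable
  using (Dec; does; yes; no; True; toWitness; map′; ¬?; _×-dec_; _→-dec_; decidable-stable; dec-true; dec-false)
open import Relation.Nullary.Negation.Core using (¬_)

-- Comparison of Cauchy reals.

quarter : ∀ {ε} → 0ℚ ℚ.< ε → ∃[ δ ] 0ℚ ℚ.< δ × δ ℚ.+ δ ℚ.+ δ ℚ.+ δ ≡ ε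
quarter {ε} 0<ε = ¼ ℚ.* ε , 0<¼ε , solve 1 (λ e → q e :+ q e :+ q e :+ q e := e) refl ε
  where
  open +-*-Solver
  ¼ : ℚ
  ¼ = ½ ℚ.* ½
  q : ∀ {n} → Polynomial n → Polynomial n
  q e = con ¼ :* e
  0<¼ε : 0ℚ ℚ.< ¼ ℚ.* ε
  0<¼ε = subst (ℚ._< ¼ ℚ.* ε) (ℚ.*-zeroʳ ¼) (ℚ.*-monoʳ-<-pos ¼ 0<ε)

p≤∣p∣ : ∀ p → p ℚ.≤ ℚ.∣ p ∣
p≤∣p∣ p with ℚ.≤-total 0ℚ p
... | inj₁ 0≤p = ℚ.≤-reflexive (sym (ℚ.0≤p⇒∣p∣≡p 0≤p))
... | inj₂ p≤0 = ℚ.≤-trans p≤0 (ℚ.0≤∣p∣ p)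

∣p-q∣<r⇒p<q+r : ∀ p q {r} → ℚ.∣ p ℚ.- q ∣ ℚ.< r → p ℚ.< q ℚ.+ r
∣p-q∣<r⇒p<q+r p q {r} d = subst (ℚ._< q ℚ.+ r)
  (solve 2 (λ p q → q :+ (p :- q) := p) refl p q)
  (ℚ.+-monoʳ-< q (ℚ.≤-<-trans (p≤∣p∣ (p ℚ.- q)) d))
  where open +-*-Solver

p≤p+q : ∀ p {q} → 0ℚ ℚ.< q → p ℚ.≤ p ℚ.+ q
p≤p+q p {q} 0<q = subst (ℚ._≤ p ℚ.+ q) (ℚ.+-identityʳ p) (ℚ.+-monoʳ-≤ p (ℚ.<⇒≤ 0<q))

-- The Cauchy condition without absolute value; `m` and `n` are interchangeable, so nothing is lost.
Settled : ℝ → ℚ → ℕ → Set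
Settled x δ N = ∀ m n → N ℕ.≤ m → N ℕ.≤ n → seq x m ℚ.< seq x n ℚ.+ δ

settles : ∀ x {δ} → 0ℚ ℚ.< δ → ∃[ N ] Settled x δ N
settles x {δ} 0<δ = let N , close = cauchy x δ 0<δ in
  N , λ m n h k → ∣p-q∣<r⇒p<q+r (seq x m) (seq x n) (close m n h k)

-- Constructive because one comparison of rationals, at an index where both
-- sequences have settled, decides between x ≤ʳ y and y ≤ x + ε.
≰ʳ⇒≥ʳ : ∀ {x y} → ¬ (x ≤ʳ y) → y ≤ʳ x
≰ʳ⇒≥ʳ {x} {y} x≰y ε 0<ε =
  -- The four quarters of `ε`: one to move `y` to the common index, two for the comparison there,
  -- one to move `x` back.
  let δ , 0<δ , 4δ≡ε = quarter 0<ε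
      M , p = settles x 0<δ
      N , q = settles y 0<δ
  in M ℕ.⊔ N , bound δ 4δ≡ε (M ℕ.⊔ N)
    (λ m n h k → p m n (ℕ.m⊔n≤o⇒m≤o M N h) (ℕ.m⊔n≤o⇒m≤o M N k))
    (λ m n h k → q m n (ℕ.m⊔n≤o⇒n≤o M N h) (ℕ.m⊔n≤o⇒n≤o M N k))
  where
  open ℚ.≤-Reasoning
  open +-*-Solver using (solve; _:+_; _:=_; :-_)

  -- If `y` led by more than 2δ at `K`, then, as `x` rises and `y` falls by less than δ afterwards,
  -- `x` would stay below `y` for good, against `x≰y`.
  near : ∀ δ K → Settled x δ K → Settled y δ K → seq y K ℚ.≤ seq x K ℚ.+ (δ ℚ.+ δ)
  near δ K x-close y-close = ℚ.≮⇒≥ λ a+2δ<b → x≰y λ ε′ 0<ε′ → K , λ n h → begin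
    seq x n                  <⟨ x-close n K h ℕ.≤-refl ⟩
    seq x K ℚ.+ δ                  ≡⟨ solve 2 (λ a d → a :+ d := a :+ (d :+ d) :+ :- d) refl (seq x K) δ ⟩
    seq x K ℚ.+ (δ ℚ.+ δ) ℚ.+ ℚ.- δ    <⟨ ℚ.+-monoˡ-< (ℚ.- δ) a+2δ<b ⟩
    seq y K ℚ.+ ℚ.- δ                  <⟨ ℚ.+-monoˡ-< (ℚ.- δ) (y-close K n ℕ.≤-refl h) ⟩
    seq y n ℚ.+ δ ℚ.+ ℚ.- δ      ≡⟨ solve 2 (λ c d → c :+ d :+ :- d := c) refl (seq y n) δ ⟩
    seq y n                  ≤⟨ p≤p+q (seq y n) 0<ε′ ⟩
    seq y n ℚ.+ ε′           ∎

  bound : ∀ δ → δ ℚ.+ δ ℚ.+ δ ℚ.+ δ ≡ ε → ∀ K → Settled x δ K → Settled y δ K →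
          ∀ n → K ℕ.≤ n → seq y n ℚ.≤ seq x n ℚ.+ ε
  bound δ 4δ≡ε K x-close y-close n h = begin
    seq y n                             <⟨ y-close n K h ℕ.≤-refl ⟩
    seq y K ℚ.+ δ                             ≤⟨ ℚ.+-monoˡ-≤ δ (near δ K x-close y-close) ⟩
    seq x K ℚ.+ (δ ℚ.+ δ) ℚ.+ δ   <⟨ ℚ.+-monoˡ-< δ (ℚ.+-monoˡ-< (δ ℚ.+ δ) (x-close K n ℕ.≤-refl h)) ⟩
    seq x n ℚ.+ δ ℚ.+ (δ ℚ.+ δ) ℚ.+ δ   ≡⟨ solve 2 (λ c d → c :+ d :+ (d :+ d) :+ d := c :+ (d :+ d :+ d :+ d))
                                             refl (seq x n) δ ⟩
    seq x n ℚ.+ (δ ℚ.+ δ ℚ.+ δ ℚ.+ δ)   ≡⟨ cong (seq x n ℚ.+_) 4δ≡ε ⟩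
    seq x n ℚ.+ ε                       ∎

-- Weights and trades between coalitions.

-- Each agent counts once for each of the two coalitions that contain it, and union and intersection
-- together preserve this multiplicity.
sum-∪-∩ : ∀ {n} (S T : Subset n) (w : Fin n → ℝ) m →
  seq (sum S w) m ℚ.+ seq (sum T w) m ≡ seq (sum (S ∪ T) w) m ℚ.+ seq (sum (S ∩ T) w) m
sum-∪-∩ []            []            w m = refl
sum-∪-∩ (outside ∷ S) (outside ∷ T) w m = sum-∪-∩ S T (w ∘ fsuc) m
sum-∪-∩ (inside ∷ S) (outside ∷ T) w m =
  trans (ℚ.+-assoc u _ _) (trans (cong (u ℚ.+_) (sum-∪-∩ S T (w ∘ fsuc) m)) (sym (ℚ.+-assoc u _ _)))
  where u = seq (w fzero) m
sum-∪-∩ (outside ∷ S) (inside ∷ T) w m =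
  trans (ℚ.+-comm s (u ℚ.+ t)) (trans (ℚ.+-assoc u t s) (trans (cong (u ℚ.+_)
    (trans (ℚ.+-comm t s) (sum-∪-∩ S T (w ∘ fsuc) m))) (sym (ℚ.+-assoc u _ _))))
  where
  u = seq (w fzero) m
  s = seq (sum S (w ∘ fsuc)) m
  t = seq (sum T (w ∘ fsuc)) m
sum-∪-∩ (inside ∷ S) (inside ∷ T) w m =
  trans (swap s t) (trans (cong (u ℚ.+ u ℚ.+_) (sum-∪-∩ S T (w ∘ fsuc) m)) (sym (swap _ _)))
  where
  u = seq (w fzero) m
  s = seq (sum S (w ∘ fsuc)) m
  t = seq (sum T (w ∘ fsuc)) m
  open +-*-Solver
  swap : ∀ s t → (u ℚ.+ s) ℚ.+ (u ℚ.+ t) ≡ u ℚ.+ u ℚ.+ (s ℚ.+ t)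
  swap = solve 3 (λ u s t → (u :+ s) :+ (u :+ t) := u :+ u :+ (s :+ t)) refl u

-- Losing only says that `q ≤ʳ` fails. For `C` this yields the weak bound w(C) ≤ q, which suffices:
-- the balance then forces q ≤ w(D), so `D` would win.
trade⇒¬weighted : ∀ {n} (G : SimpleGame n) {A B C D : Subset n} →
  SimpleGame.v G A ≡ true → SimpleGame.v G B ≡ true →
  SimpleGame.v G C ≡ false → SimpleGame.v G D ≡ false →
  A ∪ B ≡ C ∪ D → A ∩ B ≡ C ∩ D → ¬ Weighted G
trade⇒¬weighted G {A} {B} {C} {D} vA vB vC vD ∪≡ ∩≡ (w , q , _ , _ , rep) =
  lose D vD q≤D
  where
  open SimpleGame G
  lose : ∀ S → v S ≡ false → ¬ (q ≤ʳ sum S w)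
  lose S vS q≤S with trans (sym vS) (Equivalence.from (rep S) q≤S)
  ... | ()

  balance : ∀ m → seq (sum A w) m ℚ.+ seq (sum B w) m ≡ seq (sum C w) m ℚ.+ seq (sum D w) m
  balance m = trans (sum-∪-∩ A B w m)
    (trans (cong₂ (λ U I → seq (sum U w) m ℚ.+ seq (sum I w) m) ∪≡ ∩≡) (sym (sum-∪-∩ C D w m)))

  -- w(D) = w(A) + w(B) - w(C) ≥ q + q - q
  step : ∀ {a b c d r δ} → a ℚ.+ b ≡ c ℚ.+ d →
    r ℚ.≤ a ℚ.+ δ → r ℚ.≤ b ℚ.+ δ → c ℚ.≤ r ℚ.+ δ → r ℚ.≤ d ℚ.+ (δ ℚ.+ δ ℚ.+ δ)
  step {a} {b} {c} {d} {r} {δ} a+b≡c+d r≤a r≤b c≤r = begin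
    r                                         ≡⟨ solve 1 (λ r → r := r :+ r :+ :- r) refl r ⟩
    r ℚ.+ r ℚ.+ ℚ.- r                         ≤⟨ ℚ.+-monoˡ-≤ (ℚ.- r) (ℚ.+-mono-≤ r≤a r≤b) ⟩
    (a ℚ.+ δ) ℚ.+ (b ℚ.+ δ) ℚ.+ ℚ.- r         ≡⟨ solve 4 (λ a b e r → (a :+ e) :+ (b :+ e) :+ :- r := (a :+ b) :+ (e :+ e :+ :- r))
                                                   refl a b δ r ⟩
    (a ℚ.+ b) ℚ.+ (δ ℚ.+ δ ℚ.+ ℚ.- r)         ≡⟨ cong (ℚ._+ (δ ℚ.+ δ ℚ.+ ℚ.- r)) a+b≡c+d ⟩
    (c ℚ.+ d) ℚ.+ (δ ℚ.+ δ ℚ.+ ℚ.- r)         ≤⟨ ℚ.+-monoˡ-≤ (δ ℚ.+ δ ℚ.+ ℚ.- r) (ℚ.+-monoˡ-≤ d c≤r) ⟩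
    (r ℚ.+ δ ℚ.+ d) ℚ.+ (δ ℚ.+ δ ℚ.+ ℚ.- r)   ≡⟨ solve 3 (λ r d e → (r :+ e :+ d) :+ (e :+ e :+ :- r) := d :+ (e :+ e :+ e))
                                                   refl r d δ ⟩
    d ℚ.+ (δ ℚ.+ δ ℚ.+ δ)                     ∎
    where
    open ℚ.≤-Reasoning
    open +-*-Solver using (solve; _:+_; _:=_; :-_)

  q≤D : q ≤ʳ sum D w
  q≤D ε 0<ε =
    let δ , 0<δ , 4δ≡ε = quarter 0<ε
        K , q≤A = Equivalence.to (rep A) vA δ 0<δ
        L , q≤B = Equivalence.to (rep B) vB δ 0<δ
        M , C≤q = ≰ʳ⇒≥ʳ {q} {sum C w} (lose C vC) δ 0<δ
    in K ℕ.⊔ L ℕ.⊔ M , λ m h →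
      let h′ = ℕ.m⊔n≤o⇒m≤o (K ℕ.⊔ L) M h
          d  = seq (sum D w) m
      in ℚ.≤-trans
        (step {seq (sum A w) m} {seq (sum B w) m} {seq (sum C w) m} {d} (balance m)
          (q≤A m (ℕ.m⊔n≤o⇒m≤o K L h′)) (q≤B m (ℕ.m⊔n≤o⇒n≤o K L h′))
          (C≤q m (ℕ.m⊔n≤o⇒n≤o (K ℕ.⊔ L) M h)))
        -- Three δ have been spent; the fourth is slack from reusing `quarter`.
        (ℚ.≤-trans (ℚ.+-monoʳ-≤ d (p≤p+q (δ ℚ.+ δ ℚ.+ δ) 0<δ)) (ℚ.≤-reflexive (cong (d ℚ.+_) 4δ≡ε)))

-- Types of agents and games generated by coalitions.

type : (n̂ : List ℕ) → Fin (ℕ.sum n̂) → Fin (length n̂)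
type (m ∷ n̂) i = [ const fzero , fsuc ∘ type n̂ ] (splitAt m i)

module _ {n : ℕ} {P : Fin n → Set} (P? : ∀ i → Dec (P i)) where

  separate : Subset n
  separate = tabulate (does ∘ P?)

  ∈-separate⁺ : ∀ {i} → P i → i ∈ˢ separate
  ∈-separate⁺ {i} p = lookup⇒[]= i separate
    (trans (lookup∘tabulate (does ∘ P?) i) (dec-true (P? i) p))

  ∈-separate⁻ : ∀ {i} → i ∈ˢ separate → P i
  ∈-separate⁻ {i} i∈ with P? i | trans (sym ([]=⇒lookup i∈)) (lookup∘tabulate (does ∘ P?) i)
  ... | yes p | _ = p
  ... | no ¬p | ()

module _ {n t : ℕ} (τ : Fin n → Fin t) where

  fibre : Fin t → Subset n
  fibre k = separate (λ i → τ i Fin.≟ k)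

  ∈-fibre⁺ : ∀ {i k} → τ i ≡ k → i ∈ˢ fibre k
  ∈-fibre⁺ {k = k} = ∈-separate⁺ (λ i → τ i Fin.≟ k)

  ∈-fibre⁻ : ∀ {i k} → i ∈ˢ fibre k → τ i ≡ k
  ∈-fibre⁻ {k = k} = ∈-separate⁻ (λ i → τ i Fin.≟ k)

module Generated (n̂ : List ℕ) (Ws : List (Subset (ℕ.sum n̂))) where

  private
    n = ℕ.sum n̂
    t = length n̂

  -- Type `k` itself is included, so that the last `k` makes `_≽_` compare total sizes.
  upTo : Fin t → Subset n
  upTo k = separate (λ i → type n̂ i Fin.≤? k)

  infix 4 _≽_ _≽?_

  -- The dominance order on type counts: adding an agent, or exchanging one for an agent of an equal
  -- or better type, leads upwards. Winning is closed upwards in it, which makes better types at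
  -- least as desirable.
  _≽_ : Subset n → Subset n → Set
  S ≽ W = ∀ k → ∣ W ∩ upTo k ∣ ℕ.≤ ∣ S ∩ upTo k ∣

  _≽?_ : Decidable _≽_
  S ≽? W = Fin.all? λ k → ∣ W ∩ upTo k ∣ ℕ.≤? ∣ S ∩ upTo k ∣

  ⊆⇒≽ : ∀ S T → S ⊆ T → T ≽ S
  ⊆⇒≽ S T S⊆T k = p⊆q⇒∣p∣≤∣q∣ λ x∈ →
    let x∈S , x∈k = x∈p∩q⁻ S (upTo k) x∈ in x∈p∩q⁺ (S⊆T x∈S , x∈k)

  Winning : Subset n → Set
  Winning S = Any (S ≽_) Ws

  winning? : ∀ S → Dec (Winning S)
  winning? S = Any.any? (S ≽?_) Ws

  v : Subset n → Bool
  v S = does (winning? S)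

  ∈⇒winning : ∀ {W} → W ∈ Ws → Winning W
  ∈⇒winning {W} = Any.map λ { refl → ⊆⇒≽ W W ⊆-refl }

  winning-mono : ∀ S T → S ⊆ T → Winning S → Winning T
  winning-mono S T S⊆T = Any.map λ S≽W k → ℕ.≤-trans (S≽W k) (⊆⇒≽ S T S⊆T k)

  v-mono : ∀ S T → S ⊆ T → v S Bool.≤ v T
  v-mono S T S⊆T with winning? S
  ... | no  _ = Bool.≤-minimum (v T)
  ... | yes s = Bool.≤-reflexive (sym (dec-true (winning? T) (winning-mono S T S⊆T s)))

  game : ¬ Winning ⊥ → Winning ⊤ → SimpleGame n
  game ⊥-loses ⊤-wins = record
    { v        = v
    ; v-∅      = dec-false (winning? ⊥) ⊥-loses
    ; v-N      = dec-true (winning? ⊤) ⊤-wins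
    ; monotone = v-mono
    }

-- Deciding desirability; completeness and type composition.

-- Desirability quantifies over all coalitions; a search for a counterexample makes it decidable.
allSubsets? : ∀ {n} {P : Subset n → Set} → (∀ S → Dec (P S)) → Dec (∀ S → P S)
allSubsets? P? = map′
  (λ ¬∃ S → decidable-stable (P? S) λ ¬p → ¬∃ (S , ¬p))
  (λ { ∀p (S , ¬p) → ¬p (∀p S) })
  (¬? (anySubset? (¬? ∘ P?)))

module _ {n} (G : SimpleGame n) where
  open SimpleGame G

  ⊒? : Decidable (_⊒_ G)
  ⊒? i j = allSubsets? λ S →
    (j ∈? S) →-dec (¬? (i ∈? S) →-dec (v S Bool.≤? v ((⁅ i ⁆ ∪ S) - j)))

  -- One finite check from which both completeness and the equivalence classes follow. The
  -- implication from `_⊒_` back to types keeps distinct types from merging.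
  Ranked : (n̂ : List ℕ) → (Fin n → Fin (length n̂)) → Set
  Ranked n̂ τ = ∀ i j → (τ i ≤ᶠ τ j → _⊒_ G i j) × (_⊒_ G i j → τ i ≤ᶠ τ j)

  ranked? : ∀ n̂ τ → Dec (Ranked n̂ τ)
  ranked? n̂ τ = Fin.all? λ i → Fin.all? λ j →
    ((τ i Fin.≤? τ j) →-dec ⊒? i j) ×-dec (⊒? i j →-dec (τ i Fin.≤? τ j))

  module _ n̂ τ (ranked : Ranked n̂ τ) where

    private
      ≤⇒⊒ : ∀ {i j} → τ i ≤ᶠ τ j → _⊒_ G i j
      ≤⇒⊒ = proj₁ (ranked _ _)

      ⊒⇒≤ : ∀ {i j} → _⊒_ G i j → τ i ≤ᶠ τ j
      ⊒⇒≤ = proj₂ (ranked _ _)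

    ranked⇒complete : Complete G
    ranked⇒complete = record
      { isPreorder = record
        { isEquivalence = isEquivalence
        ; reflexive     = λ { {i} refl → ≤⇒⊒ (Fin.≤-refl {x = τ i}) }
        ; trans         = λ i⊒j j⊒k → ≤⇒⊒ (ℕ.≤-trans (⊒⇒≤ i⊒j) (⊒⇒≤ j⊒k))
        }
      ; total = λ i j → Sum.map ≤⇒⊒ ≤⇒⊒ (Fin.≤-total (τ i) (τ j))
      }

    -- Antisymmetry of the order on `Fin` turns mutual desirability into equality of types, so the
    -- classes of `_□_` are the fibres of `τ`.
    ranked⇒hasTypeComposition : (∀ k → ∣ fibre τ k ∣ ≡ lookup n̂ k) →
      (∀ k → Nonempty (fibre τ k)) → HasTypeComposition G n̂
    ranked⇒hasTypeComposition sizes nonempty = record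
      { class      = fibre τ
      ; nonempty   = nonempty
      ; covering   = λ i → τ i , ∈-fibre⁺ τ refl
      ; equivalent = λ k i∈k j → mk⇔
          (λ j∈k → let τi≡τj = trans (∈-fibre⁻ τ i∈k) (sym (∈-fibre⁻ τ j∈k)) in
            ≤⇒⊒ (Fin.≤-reflexive τi≡τj) , ≤⇒⊒ (Fin.≤-reflexive (sym τi≡τj)))
          (λ { (i⊒j , j⊒i) → ∈-fibre⁺ τ
            (trans (Fin.≤-antisym (⊒⇒≤ j⊒i) (⊒⇒≤ i⊒j)) (∈-fibre⁻ τ i∈k)) })
      ; decreasing = λ k<l i∈k j∈l →
          let τi<τj = subst₂ _<ᶠ_ (sym (∈-fibre⁻ τ i∈k)) (sym (∈-fibre⁻ τ j∈l)) k<l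
          in ≤⇒⊒ (ℕ.<⇒≤ τi<τj) , λ j⊒i → ℕ.<⇒≱ τi<τj (⊒⇒≤ j⊒i)
      ; sizes      = sizes
      }

-- Certificates for non-weighted games.

NonWeightedGame : List ℕ → Set
NonWeightedGame n̂ = ∃[ n ] Σ[ G ∈ SimpleGame n ]
  Complete G × HasTypeComposition G n̂ × ¬ Weighted G

module _ (n̂ : List ℕ) (A B : Subset (ℕ.sum n̂)) (Ws : List (Subset (ℕ.sum n̂)))
         (C D : Subset (ℕ.sum n̂)) where
  open Generated n̂ (A ∷ B ∷ Ws)

  module _ (C-loses : ¬ Winning C) where

    -- The losing `C` contains the empty coalition and the winning `A` lies in the full one, which
    -- settles both boundary values. `C-loses` stays outside `Valid` because the game that `Valid`
    -- speaks of is built from it.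
    generatedGame : SimpleGame (ℕ.sum n̂)
    generatedGame = game (λ ⊥-wins → C-loses (winning-mono ⊥ C ⊥⊆ ⊥-wins))
      (winning-mono A ⊤ ⊆⊤ (∈⇒winning (here refl)))

    Valid : Set
    Valid = ¬ Winning D × A ∪ B ≡ C ∪ D × A ∩ B ≡ C ∩ D ×
      (∀ k → ∣ fibre (type n̂) k ∣ ≡ lookup n̂ k) ×
      (∀ k → Nonempty (fibre (type n̂) k)) ×
      Ranked generatedGame n̂ (type n̂)

    valid? : Dec Valid
    valid? = ¬? (winning? D) ×-dec ≡-dec Bool._≟_ _ _ ×-dec ≡-dec Bool._≟_ _ _ ×-dec
      Fin.all? (λ k → ∣ fibre (type n̂) k ∣ ℕ.≟ lookup n̂ k) ×-dec
      Fin.all? (nonempty? ∘ fibre (type n̂)) ×-dec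
      ranked? generatedGame n̂ (type n̂)

    valid⇒nonWeightedGame : Valid → NonWeightedGame n̂
    valid⇒nonWeightedGame (D-loses , ∪≡ , ∩≡ , sizes , nonempty , ranked) =
      ℕ.sum n̂ , generatedGame ,
      ranked⇒complete generatedGame n̂ (type n̂) ranked ,
      ranked⇒hasTypeComposition generatedGame n̂ (type n̂) ranked sizes nonempty ,
      trade⇒¬weighted generatedGame {A} {B} {C} {D} (wins A (here refl)) (wins B (there (here refl)))
        (dec-false (winning? C) C-loses) (dec-false (winning? D) D-loses) ∪≡ ∩≡
      where
      wins : ∀ W → W ∈ A ∷ B ∷ Ws → v W ≡ true
      wins W W∈ = dec-true (winning? W) (∈⇒winning W∈)

  -- For concrete coalitions both implicit arguments have types that evaluate to the unit type, so
  -- type checking a call runs the whole certificate check.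
  nonWeightedGame : {C-loses : True (¬? (winning? C))} →
    {True (valid? (toWitness C-loses))} → NonWeightedGame n̂
  nonWeightedGame {C-loses} {valid} = valid⇒nonWeightedGame (toWitness C-loses) (toWitness valid)

-- The eighteen games.

-- Agents are listed from the most to the least desirable.
pattern ● = inside
pattern ○ = outside

games : All NonWeightedGame typeCompositions
games =
  -- `A` and `B` both have type counts (1,2). Trading one agent of the first type for two of the
  -- second leaves `C` with (0,4), lacking the first type, and `D` with (2,0), too small.
  nonWeightedGame (2 ∷ 4 ∷ [])
    (● ∷ ○ ∷ ● ∷ ● ∷ ○ ∷ ○ ∷ [])
    (○ ∷ ● ∷ ○ ∷ ○ ∷ ● ∷ ● ∷ [])
    []
    (○ ∷ ○ ∷ ● ∷ ● ∷ ● ∷ ● ∷ [])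
    (● ∷ ● ∷ ○ ∷ ○ ∷ ○ ∷ ○ ∷ []) ∷
  nonWeightedGame (2 ∷ 2 ∷ 2 ∷ [])
    (● ∷ ○ ∷ ● ∷ ○ ∷ ● ∷ ○ ∷ [])
    (○ ∷ ● ∷ ○ ∷ ● ∷ ○ ∷ ● ∷ [])
    []
    (○ ∷ ○ ∷ ● ∷ ● ∷ ● ∷ ● ∷ [])
    (● ∷ ● ∷ ○ ∷ ○ ∷ ○ ∷ ○ ∷ []) ∷
  nonWeightedGame (1 ∷ 1 ∷ 5 ∷ [])
    (○ ∷ ● ∷ ● ∷ ● ∷ ● ∷ ○ ∷ ○ ∷ [])
    (● ∷ ○ ∷ ○ ∷ ○ ∷ ○ ∷ ● ∷ ● ∷ [])
    []
    (○ ∷ ○ ∷ ● ∷ ● ∷ ● ∷ ● ∷ ● ∷ [])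
    (● ∷ ● ∷ ○ ∷ ○ ∷ ○ ∷ ○ ∷ ○ ∷ []) ∷
  nonWeightedGame (1 ∷ 2 ∷ 3 ∷ [])
    (○ ∷ ● ∷ ○ ∷ ● ∷ ● ∷ ● ∷ [])
    (● ∷ ○ ∷ ● ∷ ○ ∷ ○ ∷ ○ ∷ [])
    []
    (○ ∷ ● ∷ ● ∷ ● ∷ ○ ∷ ○ ∷ [])
    (● ∷ ○ ∷ ○ ∷ ○ ∷ ● ∷ ● ∷ []) ∷
  nonWeightedGame (1 ∷ 3 ∷ 2 ∷ [])
    (○ ∷ ● ∷ ● ∷ ○ ∷ ● ∷ ● ∷ [])
    (● ∷ ○ ∷ ○ ∷ ● ∷ ○ ∷ ○ ∷ [])
    []
    (○ ∷ ● ∷ ● ∷ ● ∷ ○ ∷ ○ ∷ [])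
    (● ∷ ○ ∷ ○ ∷ ○ ∷ ● ∷ ● ∷ []) ∷
  nonWeightedGame (2 ∷ 1 ∷ 4 ∷ [])
    (● ∷ ○ ∷ ○ ∷ ● ∷ ● ∷ ○ ∷ ○ ∷ [])
    (○ ∷ ● ∷ ○ ∷ ○ ∷ ○ ∷ ● ∷ ● ∷ [])
    -- `A` and `B` alone ask for one agent of the first type and three agents in all, which would
    -- merge the other two types. This coalition wins, but exchanging its agent of the second type
    -- for one of the third gives the losing `C`.
    ((○ ∷ ○ ∷ ● ∷ ● ∷ ● ∷ ● ∷ ○ ∷ []) ∷ [])
    (○ ∷ ○ ∷ ○ ∷ ● ∷ ● ∷ ● ∷ ● ∷ [])
    (● ∷ ● ∷ ○ ∷ ○ ∷ ○ ∷ ○ ∷ ○ ∷ []) ∷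
  -- The game for (2,4) with a null agent added: three agents of the first two types are already
  -- required, so the last agent never matters.
  nonWeightedGame (2 ∷ 4 ∷ 1 ∷ [])
    (● ∷ ○ ∷ ● ∷ ● ∷ ○ ∷ ○ ∷ ○ ∷ [])
    (○ ∷ ● ∷ ○ ∷ ○ ∷ ● ∷ ● ∷ ○ ∷ [])
    []
    (○ ∷ ○ ∷ ● ∷ ● ∷ ● ∷ ● ∷ ○ ∷ [])
    (● ∷ ● ∷ ○ ∷ ○ ∷ ○ ∷ ○ ∷ ○ ∷ []) ∷
  -- The coalitions for (1,2,3) again: splitting the middle type only adds a condition to `_≽_`, so
  -- `C` and `D` still lose.
  nonWeightedGame (1 ∷ 1 ∷ 1 ∷ 3 ∷ [])
    (○ ∷ ● ∷ ○ ∷ ● ∷ ● ∷ ● ∷ [])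
    (● ∷ ○ ∷ ● ∷ ○ ∷ ○ ∷ ○ ∷ [])
    []
    (○ ∷ ● ∷ ● ∷ ● ∷ ○ ∷ ○ ∷ [])
    (● ∷ ○ ∷ ○ ∷ ○ ∷ ● ∷ ● ∷ []) ∷
  nonWeightedGame (1 ∷ 1 ∷ 3 ∷ 1 ∷ [])
    (○ ∷ ● ∷ ● ∷ ● ∷ ○ ∷ ○ ∷ [])
    (● ∷ ○ ∷ ○ ∷ ○ ∷ ● ∷ ● ∷ [])
    []
    (○ ∷ ○ ∷ ● ∷ ● ∷ ● ∷ ● ∷ [])
    (● ∷ ● ∷ ○ ∷ ○ ∷ ○ ∷ ○ ∷ []) ∷
  nonWeightedGame (2 ∷ 1 ∷ 2 ∷ 1 ∷ [])
    (● ∷ ○ ∷ ○ ∷ ● ∷ ● ∷ ○ ∷ [])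
    (○ ∷ ● ∷ ● ∷ ○ ∷ ○ ∷ ● ∷ [])
    []
    (○ ∷ ○ ∷ ● ∷ ● ∷ ● ∷ ● ∷ [])
    (● ∷ ● ∷ ○ ∷ ○ ∷ ○ ∷ ○ ∷ []) ∷
  nonWeightedGame (2 ∷ 3 ∷ 1 ∷ 1 ∷ [])
    (○ ∷ ○ ∷ ● ∷ ● ∷ ● ∷ ○ ∷ ● ∷ [])
    (● ∷ ● ∷ ○ ∷ ○ ∷ ○ ∷ ● ∷ ○ ∷ [])
    []
    (● ∷ ○ ∷ ● ∷ ○ ∷ ○ ∷ ● ∷ ● ∷ [])
    (○ ∷ ● ∷ ○ ∷ ● ∷ ● ∷ ○ ∷ ○ ∷ []) ∷
  nonWeightedGame (1 ∷ 2 ∷ 2 ∷ 1 ∷ [])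
    (○ ∷ ● ∷ ● ∷ ○ ∷ ○ ∷ ● ∷ [])
    (● ∷ ○ ∷ ○ ∷ ● ∷ ● ∷ ○ ∷ [])
    []
    (○ ∷ ● ∷ ○ ∷ ● ∷ ● ∷ ● ∷ [])
    (● ∷ ○ ∷ ● ∷ ○ ∷ ○ ∷ ○ ∷ []) ∷
  nonWeightedGame (1 ∷ 2 ∷ 1 ∷ 2 ∷ [])
    (○ ∷ ● ∷ ● ∷ ○ ∷ ● ∷ ○ ∷ [])
    (● ∷ ○ ∷ ○ ∷ ● ∷ ○ ∷ ● ∷ [])
    []
    (○ ∷ ● ∷ ○ ∷ ● ∷ ● ∷ ● ∷ [])
    (● ∷ ○ ∷ ● ∷ ○ ∷ ○ ∷ ○ ∷ []) ∷
  nonWeightedGame (1 ∷ 1 ∷ 2 ∷ 2 ∷ [])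
    (○ ∷ ● ∷ ● ∷ ○ ∷ ● ∷ ● ∷ [])
    (● ∷ ○ ∷ ○ ∷ ● ∷ ○ ∷ ○ ∷ [])
    []
    (○ ∷ ● ∷ ● ∷ ● ∷ ○ ∷ ○ ∷ [])
    (● ∷ ○ ∷ ○ ∷ ○ ∷ ● ∷ ● ∷ []) ∷
  -- Likewise the coalitions for (1,2,1,2), with the last type split.
  nonWeightedGame (1 ∷ 2 ∷ 1 ∷ 1 ∷ 1 ∷ [])
    (○ ∷ ● ∷ ● ∷ ○ ∷ ● ∷ ○ ∷ [])
    (● ∷ ○ ∷ ○ ∷ ● ∷ ○ ∷ ● ∷ [])
    []
    (○ ∷ ● ∷ ○ ∷ ● ∷ ● ∷ ● ∷ [])
    (● ∷ ○ ∷ ● ∷ ○ ∷ ○ ∷ ○ ∷ []) ∷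
  nonWeightedGame (1 ∷ 1 ∷ 2 ∷ 1 ∷ 1 ∷ [])
    (○ ∷ ● ∷ ● ∷ ○ ∷ ● ∷ ○ ∷ [])
    (● ∷ ○ ∷ ○ ∷ ● ∷ ○ ∷ ● ∷ [])
    []
    (○ ∷ ○ ∷ ● ∷ ● ∷ ● ∷ ● ∷ [])
    (● ∷ ● ∷ ○ ∷ ○ ∷ ○ ∷ ○ ∷ []) ∷
  nonWeightedGame (1 ∷ 1 ∷ 1 ∷ 2 ∷ 1 ∷ [])
    (○ ∷ ● ∷ ○ ∷ ● ∷ ● ∷ ○ ∷ [])
    (● ∷ ○ ∷ ● ∷ ○ ∷ ○ ∷ ● ∷ [])
    []
    (○ ∷ ○ ∷ ● ∷ ● ∷ ● ∷ ● ∷ [])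
    (● ∷ ● ∷ ○ ∷ ○ ∷ ○ ∷ ○ ∷ []) ∷
  nonWeightedGame (1 ∷ 1 ∷ 1 ∷ 1 ∷ 2 ∷ [])
    (○ ∷ ● ∷ ● ∷ ○ ∷ ● ∷ ○ ∷ [])
    (● ∷ ○ ∷ ○ ∷ ● ∷ ○ ∷ ● ∷ [])
    -- Separates the second agent from the third, which `A` and `B` alone would leave equivalent:
    -- exchanging the second for the third here gives the losing `C`.
    ((○ ∷ ● ∷ ○ ∷ ● ∷ ● ∷ ● ∷ []) ∷ [])
    (○ ∷ ○ ∷ ● ∷ ● ∷ ● ∷ ● ∷ [])
    (● ∷ ● ∷ ○ ∷ ○ ∷ ○ ∷ ○ ∷ []) ∷
  []

lemma5 : (n̂ : List ℕ) → n̂ ∈ typeCompositions →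
    ∃[ n ] Σ[ G ∈ SimpleGame n ]
    Complete G × HasTypeComposition G n̂ × ¬ Weighted G
lemma5 n̂ = All.lookup games
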